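{- Let $k \ge 1$ be an integer and let $G$ be a connected $k$-SI graph with at least two vertices, of order $n(G)$, size $m(G)$, and maximum degree $\Delta(G)$. Suppose that $G \not\cong K_{\Delta(G), \Delta(G)-k}$ and $\gcd(\Delta(G), k) = 1$. Then $$m(G) \le (\Delta(G) - k)(n(G) - \Delta(G) + k - 1).$$ Moreover, equality holds if and only if $C_d(G) = 3$ and $|X| = \Delta(G) - k + 1$, where $X$ is the part of the bipartition of $G$ that contains a vertex of maximum degree.
   Context: Graphs are finite and simple. For a positive integer $k$, a graph $G$ is a $k$-stepwise irregular graph ($k$-SI graph) if $|d_G(u) - d_G(v)| = k$ for every edge $uv \in E(G)$, where $d_G(x)$ is the degree of $x$ in $G$. Every $k$-SI graph is bipartite, and in a connected $k$-SI graph with at least two vertices all vertices of maximum degree lie in the same part of the (unique) bipartition. The order $n(G)$ is the number of vertices and the size $m(G)$ is the number of edges. The degree complexity $C_d(G)$ is the number of distinct vertex degrees occurring in $G$. $K_{p,q}$ denotes the complete bipartite graph with parts of sizes $p$ and $q$. -}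

module Defs where

open import Data.Empty using (⊥)
open import Data.Fin.Base using (Fin; splitAt)
open import Data.Fin.Properties using (_<?_)
open import Data.Fin.Subset using (Subset; _∈_; _∉_; ∣_∣)
open import Data.List.Base using (List; allFin; cartesianProduct; deduplicate; filter; length; map)
open import Data.List.Extrema.Nat using (max)
open import Data.Nat.Base using (ℕ; _+_; ∣_-_∣)
open import Data.Nat.Properties using (_≟_)
open import Data.Product.Base using (_×_; _,_)
open import Data.Sum.Base using (_⊎_; inj₁; inj₂)
open import Data.Unit.Base using (⊤; tt)
open import Data.Vec.Base using (tabulate)
open import Function.Bundles using (_↔_; _⇔_; Inverse)
open import Level using (0ℓ)
open import Relation.Binary.Core using (Rel)
open import Relation.Binary.Construct.Closure.ReflexiveTransitive using (Star)
open import Relation.Binary.Definitions using (Decidable; Irreflexive; Symmetric)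
open import Relation.Binary.PropositionalEquality using (_≡_; refl)
open import Relation.Nullary using (¬_)
open import Relation.Nullary.Decidable using (yes; no; does; _×-dec_)

record Graph : Set₁ where
  field
    order  : ℕ
    Adj    : Rel (Fin order) 0ℓ
    adj?   : Decidable Adj
    sym    : Symmetric Adj
    irrefl : Irreflexive _≡_ Adj

  Vertex : Set
  Vertex = Fin order

  neighbourhood : Vertex → Subset order
  neighbourhood u = tabulate λ v → does (adj? u v)

  degree : Vertex → ℕ
  degree u = ∣ neighbourhood u ∣

  -- Each edge is listed once, as the pair of its endpoints in increasing order.
  edges : List (Vertex × Vertex)
  edges = filter (λ (u , v) → (u <? v) ×-dec adj? u v)
                 (cartesianProduct (allFin order) (allFin order))

  size : ℕ
  size = length edges

  degrees : List ℕ
  degrees = map degree (allFin order)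

  -- The graph without vertices gets maximum degree 0.
  maxDegree : ℕ
  maxDegree = max 0 degrees

  degreeComplexity : ℕ
  degreeComplexity = length (deduplicate _≟_ degrees)

  Connected : Set
  Connected = ∀ (u v : Vertex) → Star Adj u v

  StepwiseIrregular : ℕ → Set
  StepwiseIrregular k = ∀ {u v : Vertex} → Adj u v → ∣ degree u - degree v ∣ ≡ k

  record IsBipartition (X Y : Subset order) : Set where
    field
      cover        : ∀ v → v ∈ X ⊎ v ∈ Y
      disjoint     : ∀ {v} → v ∈ X → v ∉ Y
      independentˣ : ∀ {u v} → u ∈ X → v ∈ X → ¬ Adj u v
      independentʸ : ∀ {u v} → u ∈ Y → v ∈ Y → ¬ Adj u v

open Graph public using
  ( order; size; degree; maxDegree; degreeComplexity
  ; Connected; StepwiseIrregular; IsBipartition )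

infix 4 _≅_

record _≅_ (G H : Graph) : Set where
  field
    bijection : Fin (order G) ↔ Fin (order H)
    adjacency : ∀ u v → Graph.Adj G u v ⇔
                Graph.Adj H (Inverse.to bijection u) (Inverse.to bijection v)

module _ {A B : Set} where

  OppositeSides : Rel (A ⊎ B) 0ℓ
  OppositeSides (inj₁ _) (inj₁ _) = ⊥
  OppositeSides (inj₁ _) (inj₂ _) = ⊤
  OppositeSides (inj₂ _) (inj₁ _) = ⊤
  OppositeSides (inj₂ _) (inj₂ _) = ⊥

  oppositeSides? : Decidable OppositeSides
  oppositeSides? (inj₁ _) (inj₁ _) = no λ ()
  oppositeSides? (inj₁ _) (inj₂ _) = yes tt
  oppositeSides? (inj₂ _) (inj₁ _) = yes tt
  oppositeSides? (inj₂ _) (inj₂ _) = no λ ()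

  oppositeSides-sym : Symmetric OppositeSides
  oppositeSides-sym {inj₁ _} {inj₂ _} _ = tt
  oppositeSides-sym {inj₂ _} {inj₁ _} _ = tt

  oppositeSides-irrefl : ∀ s → ¬ OppositeSides s s
  oppositeSides-irrefl (inj₁ _) ()
  oppositeSides-irrefl (inj₂ _) ()

-- The parts of K p q are the first p and the last q elements of Fin (p + q).
K : ℕ → ℕ → Graph
K p q = record
  { order  = p + q
  ; Adj    = λ u v → OppositeSides (splitAt p u) (splitAt p v)
  ; adj?   = λ u v → oppositeSides? (splitAt p u) (splitAt p v)
  ; sym    = λ {u} {v} → oppositeSides-sym {x = splitAt p u} {y = splitAt p v}
  ; irrefl = λ { {u} refl → oppositeSides-irrefl (splitAt p u) }
  }

{-# OPTIONS --safe #-}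
-- Every x ∈ X has degree Δ − 2ik and every y ∈ Y has degree Δ − (2i+1)k for some i, so counting
-- edges from Y gives m ≤ (Δ − k)|Y| = (Δ − k)(n − |X|).  A neighbour of a vertex v of maximum
-- degree has degree Δ − k and all its neighbours lie in X, so |X| ≥ Δ − k.  If |X| = Δ − k, then every
-- neighbour of v is adjacent to all of X, which forces N(x) = N(v) for every x ∈ X, and G is
-- complete bipartite.  Otherwise |X| ≥ Δ − k + 1, and the bound follows.  Equality means
-- that |X| = Δ − k + 1 and all of Y has degree Δ − k; then X has degrees in {Δ, Δ − 2k}, and
-- Δ − 2k occurs because otherwise Δ − k divides (Δ − k + 1)Δ, hence Δ − k = 1 by coprimality and
-- G is a star.  Conversely, a degree other than Δ − k in Y would force four distinct degrees.
module Submission where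

open import Defs
open import Data.Fin.Subset using (Subset; _∈_) renaming (∣_∣ to card)
open import Data.Nat.Base as ℕ using (ℕ; _∸_)
open import Data.Nat.GCD using (gcd)
open import Data.Product.Base using (_×_; ∃-syntax)
open import Function.Bundles using (_⇔_)
open import Relation.Binary.PropositionalEquality using (_≡_)
open import Relation.Nullary using (¬_)

open import Data.Bool.Base using (Bool; true; false; _∧_; if_then_else_)
open import Data.Bool.Properties using (∧-zeroʳ)
open import Data.Fin.Base using (Fin; zero; suc; fromℕ<; splitAt; join)
open import Data.Fin.Properties as Fin using (splitAt-join)
open import Data.Fin.Subset using (_⊆_; ∁; ⁅_⁆)
open import Data.Fin.Subset.Properties
  using ( _∈?_; p⊆q⇒∣p∣≤∣q∣; p⊂q⇒∣p∣<∣q∣; x∈p⇒x∉∁p; x∉p⇒x∈∁p; x∈∁p⇒x∉p; ∣∁p∣≡n∸∣p∣; ∣p∣≤n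
        ; ⊆-antisym; x∈⁅x⁆; x∈⁅y⁆⇒x≡y; ∣⁅x⁆∣≡1 )
open import Data.Integer.Base as ℤ using (+_)
import Data.Integer.Properties as ℤ
open import Data.Integer.Tactic.RingSolver using (solve-∀)
open import Data.List.Base as List using (List; []; _∷_; _++_; length; filter; cartesianProduct)
open import Data.List.Extrema.Nat using (xs≤max; argmax-sel)
open import Data.List.Membership.Propositional using () renaming (_∈_ to _∈ˡ_)
open import Data.List.Membership.Propositional.Properties
  using (∈-∃++; ∈-++⁺ˡ; ∈-++⁺ʳ; ∈-++⁻; ∈-map⁺; ∈-map⁻; ∈-allFin; ∈-deduplicate⁺; ∈-deduplicate⁻)
import Data.List.Properties as List
open import Data.List.Relation.Unary.All as All using ([]; _∷_)
open import Data.List.Relation.Unary.AllPairs using ([]; _∷_)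
open import Data.List.Relation.Unary.Any using (here; there)
open import Data.List.Relation.Unary.Unique.Propositional using (Unique)
open import Data.List.Relation.Unary.Unique.DecPropositional.Properties using (deduplicate-!)
open import Data.Nat.Base using (zero; suc; z≤n; s≤s; parity; >-nonZero; ∣_-_∣)
open import Data.Nat.Divisibility using (_∣_; divides; ∣m+n∣m⇒∣n; m∣m*n; ∣1⇒≡1; ∣-refl)
open import Data.Nat.GCD using (gcd-greatest)
open import Data.Nat.Properties
open import Data.Parity.Base using (0ℙ; 1ℙ; _⁻¹)
open import Data.Parity.Properties using (suc-homo-⁻¹; p≢p⁻¹; ⁻¹-selfInverse) renaming (_≟_ to _≟ᵖ_)
open import Data.Product.Base as Product using (∃; _,_; proj₁; proj₂)
open import Data.Sum.Base as Sum using (_⊎_; inj₁; inj₂; [_,_]′)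
open import Data.Unit.Base using (tt)
open import Data.Vec.Base using ([]; _∷_; here; there; lookup; tabulate)
open import Data.Vec.Properties using ([]=⇒lookup; lookup⇒[]=; lookup∘tabulate)
open import Function.Base using (_∘_; id)
open import Function.Bundles using (_↔_; Equivalence; mk↔ₛ′; mk⇔)
open import Function.Construct.Composition using (_↔-∘_)
open import Relation.Binary.Construct.Closure.ReflexiveTransitive using (Star; ε; _◅_)
open import Relation.Binary.Definitions using (tri<; tri≈; tri>)
open import Relation.Binary.PropositionalEquality
  using (_≢_; refl; sym; trans; cong; cong₂; subst; subst₂; module ≡-Reasoning)
open import Relation.Nullary.Decidable using (yes; no; does; dec-true; dec-false; _×-dec_)
open import Relation.Nullary.Negation using (contradiction)
open import Relation.Unary using (Pred; Decidable)

-- Finite sums, and lengths of filtered lists as sums of indicators.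

module Sums where

  open import Data.Nat.Base using (_+_; _*_; _≤_)
  open import Algebra.Properties.Semiring.Sum +-*-semiring public

  𝟙 : Bool → ℕ
  𝟙 b = if b then 1 else 0

  sum-mono-≤ : ∀ {n} {f g : Fin n → ℕ} → (∀ i → f i ≤ g i) → sum f ≤ sum g
  sum-mono-≤ {zero}  f≤g = z≤n
  sum-mono-≤ {suc n} f≤g = +-mono-≤ (f≤g zero) (sum-mono-≤ (f≤g ∘ suc))

  -- The tails are already ordered, so cancelling them in the equation leaves the reverse inequality
  -- at the head; the recursion then treats the tails, whose sums now agree.
  sum-≤-equality : ∀ {n} {f g : Fin n → ℕ} → (∀ i → f i ≤ g i) → sum f ≡ sum g → ∀ i → f i ≡ g i
  sum-≤-equality {suc n} {f} {g} f≤g eq = λ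
    { zero    → head≡
    ; (suc i) → sum-≤-equality (f≤g ∘ suc)
                  (+-cancelˡ-≡ (f zero) _ _ (trans eq (cong (_+ sum (g ∘ suc)) (sym head≡)))) i }
    where
    head≡ : f zero ≡ g zero
    head≡ = ≤-antisym (f≤g zero)
      (+-cancelʳ-≤ (sum (f ∘ suc)) _ _
        (≤-trans (+-monoʳ-≤ (g zero) (sum-mono-≤ (f≤g ∘ suc))) (≤-reflexive (sym eq))))

  card-sum : ∀ {n} (p : Subset n) → card p ≡ sum (𝟙 ∘ lookup p)
  card-sum []          = refl
  card-sum (true  ∷ p) = cong suc (card-sum p)
  card-sum (false ∷ p) = card-sum p

  length-filter-tabulate : ∀ {a p} {A : Set a} {P : Pred A p} (P? : Decidable P) {n} (f : Fin n → A) →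
                           length (filter P? (List.tabulate f)) ≡ ∑[ i < n ] 𝟙 (does (P? (f i)))
  length-filter-tabulate P? {zero}  f = refl
  length-filter-tabulate P? {suc n} f with does (P? (f zero))
  ... | true  = cong suc (length-filter-tabulate P? (f ∘ suc))
  ... | false = length-filter-tabulate P? (f ∘ suc)

  -- `size` is the length of a list of this shape; as a double sum it admits an exchange of
  -- summation.
  length-filter-cartesianProduct :
    ∀ {a b p} {A : Set a} {B : Set b} {P : Pred (A × B) p} (P? : Decidable P)
    {m n} (f : Fin m → A) (g : Fin n → B) →
    length (filter P? (cartesianProduct (List.tabulate f) (List.tabulate g)))
      ≡ ∑[ i < m ] ∑[ j < n ] 𝟙 (does (P? (f i , g j)))
  length-filter-cartesianProduct P? {zero}      f g = refl
  length-filter-cartesianProduct P? {suc m} {n} f g = begin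
    length (filter P? (row ++ rest))                   ≡⟨ cong length (List.filter-++ P? row rest) ⟩
    length (filter P? row ++ filter P? rest)           ≡⟨ List.length-++ (filter P? row) ⟩
    length (filter P? row) + length (filter P? rest)
      ≡⟨ cong₂ _+_
           (trans (cong (length ∘ filter P?) (List.map-tabulate g (f zero ,_)))
                  (length-filter-tabulate P? λ j → f zero , g j))
           (length-filter-cartesianProduct P? (f ∘ suc) g) ⟩
    ∑[ i < suc m ] ∑[ j < n ] 𝟙 (does (P? (f i , g j))) ∎
    where
    open ≡-Reasoning
    row  = List.map (f zero ,_) (List.tabulate g)
    rest = cartesianProduct (List.tabulate (f ∘ suc)) (List.tabulate g)

-- Finite lists and subsets: cardinality arguments and bijections.

module Finite where

  open import Data.Nat.Base using (_+_; _≤_; _<_)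

  -- One occurrence of `x` is cut out of `ys`, and uniqueness keeps the rest of `xs` inside what
  -- remains. With the deduplicated degree list on one side or the other, this bounds
  -- `degreeComplexity` from above or from below.
  Unique-⊆⇒length-≤ : ∀ {a} {A : Set a} {xs ys : List A} →
                      Unique xs → (∀ {z} → z ∈ˡ xs → z ∈ˡ ys) → length xs ≤ length ys
  Unique-⊆⇒length-≤ []                 xs⊆ys = z≤n
  Unique-⊆⇒length-≤ {A = A} {x ∷ xs} (x∉xs ∷ xs!) xs⊆ys
    with as , bs , refl ← ∈-∃++ (xs⊆ys (here refl)) = begin
      suc (length xs)         ≤⟨ s≤s (Unique-⊆⇒length-≤ xs! xs⊆as++bs) ⟩
      suc (length (as ++ bs)) ≡⟨ List.length-++-sucʳ as x bs ⟨
      length (as ++ x ∷ bs)   ∎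
    where
    open ≤-Reasoning
    xs⊆as++bs : ∀ {z} → z ∈ˡ xs → z ∈ˡ as ++ bs
    xs⊆as++bs z∈xs with ∈-++⁻ as (xs⊆ys (there z∈xs))
    ... | inj₁ z∈as         = ∈-++⁺ˡ z∈as
    ... | inj₂ (here refl)  = contradiction refl (All.lookup x∉xs z∈xs)
    ... | inj₂ (there z∈bs) = ∈-++⁺ʳ as z∈bs

  another : ∀ {n} → 2 ≤ n → (i : Fin n) → ∃ λ j → i ≢ j
  another (s≤s (s≤s _)) zero    = suc zero , λ ()
  another (s≤s (s≤s _)) (suc i) = zero , λ ()

  ∣-∣≡⇒+≡ : ∀ m n {k} → ∣ m - n ∣ ≡ k → m + k ≡ n ⊎ n + k ≡ m
  ∣-∣≡⇒+≡ m n refl with ≤-total m n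
  ... | inj₁ m≤n = inj₁ (trans (cong (_+_ m) (m≤n⇒∣m-n∣≡n∸m m≤n)) (m+[n∸m]≡n m≤n))
  ... | inj₂ n≤m = inj₂ (trans (cong (_+_ n) (trans (∣-∣-comm m n) (m≤n⇒∣m-n∣≡n∸m n≤m))) (m+[n∸m]≡n n≤m))

  module _ {n p} {P : Pred (Fin n) p} (P? : Decidable P) where

    -- This has the shape of `neighbourhood`, so the two membership lemmas below apply to
    -- neighbourhoods directly.
    comprehension : Subset n
    comprehension = tabulate (does ∘ P?)

    ∈-comprehension⁺ : ∀ {i} → P i → i ∈ comprehension
    ∈-comprehension⁺ {i} Pi = lookup⇒[]= i _ (trans (lookup∘tabulate (does ∘ P?) i) (dec-true (P? i) Pi))

    ∈-comprehension⁻ : ∀ {i} → i ∈ comprehension → P i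
    ∈-comprehension⁻ {i} i∈ with P? i | trans (sym (lookup∘tabulate (does ∘ P?) i)) ([]=⇒lookup i∈)
    ... | yes Pi | _  = Pi
    ... | no  _  | ()

  module _ {n} {p q : Subset n} where

    ⊆∧card≥⇒⊇ : p ⊆ q → card q ≤ card p → q ⊆ p
    ⊆∧card≥⇒⊇ p⊆q q≤p {x} x∈q with x ∈? p
    ... | yes x∈p = x∈p
    ... | no  x∉p = contradiction (p⊂q⇒∣p∣<∣q∣ (p⊆q , x , x∈q , x∉p)) (≤⇒≯ q≤p)

  card≡1⇒unique : ∀ {n} {p : Subset n} {x y} → card p ≡ 1 → x ∈ p → y ∈ p → y ≡ x
  card≡1⇒unique {p = p} {x} p≡1 x∈p y∈p = x∈⁅y⁆⇒x≡y x (⊆∧card≥⇒⊇ ⁅x⁆⊆p p≤⁅x⁆ y∈p)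
    where
    ⁅x⁆⊆p : ⁅ x ⁆ ⊆ p
    ⁅x⁆⊆p z∈⁅x⁆ = subst (_∈ p) (sym (x∈⁅y⁆⇒x≡y x z∈⁅x⁆)) x∈p
    p≤⁅x⁆ : card p ≤ card ⁅ x ⁆
    p≤⁅x⁆ = ≤-reflexive (trans p≡1 (sym (∣⁅x⁆∣≡1 x)))

  -- Sends an index to its rank within `p` or within the complement. Being bijective, it supplies
  -- the vertex map of the isomorphism with `K`.
  split : ∀ {n} (p : Subset n) → Fin n → Fin (card p) ⊎ Fin (card (∁ p))
  split (true  ∷ p) zero    = inj₁ zero
  split (true  ∷ p) (suc i) = Sum.map₁ suc (split p i)
  split (false ∷ p) zero    = inj₂ zero
  split (false ∷ p) (suc i) = Sum.map₂ suc (split p i)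

  unsplit : ∀ {n} (p : Subset n) → Fin (card p) ⊎ Fin (card (∁ p)) → Fin n
  unsplit (true  ∷ p) (inj₁ zero)    = zero
  unsplit (true  ∷ p) (inj₁ (suc i)) = suc (unsplit p (inj₁ i))
  unsplit (true  ∷ p) (inj₂ j)       = suc (unsplit p (inj₂ j))
  unsplit (false ∷ p) (inj₁ i)       = suc (unsplit p (inj₁ i))
  unsplit (false ∷ p) (inj₂ zero)    = zero
  unsplit (false ∷ p) (inj₂ (suc j)) = suc (unsplit p (inj₂ j))

  unsplit-split : ∀ {n} (p : Subset n) i → unsplit p (split p i) ≡ i
  unsplit-split (true  ∷ p) zero    = refl
  unsplit-split (true  ∷ p) (suc i) with split p i | unsplit-split p i
  ... | inj₁ _ | eq = cong suc eq
  ... | inj₂ _ | eq = cong suc eq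
  unsplit-split (false ∷ p) zero    = refl
  unsplit-split (false ∷ p) (suc i) with split p i | unsplit-split p i
  ... | inj₁ _ | eq = cong suc eq
  ... | inj₂ _ | eq = cong suc eq

  split-unsplit : ∀ {n} (p : Subset n) s → split p (unsplit p s) ≡ s
  split-unsplit []          (inj₁ ())
  split-unsplit []          (inj₂ ())
  split-unsplit (true  ∷ p) (inj₁ zero)    = refl
  split-unsplit (true  ∷ p) (inj₁ (suc i)) = cong (Sum.map₁ suc) (split-unsplit p (inj₁ i))
  split-unsplit (true  ∷ p) (inj₂ j)       = cong (Sum.map₁ suc) (split-unsplit p (inj₂ j))
  split-unsplit (false ∷ p) (inj₁ i)       = cong (Sum.map₂ suc) (split-unsplit p (inj₁ i))
  split-unsplit (false ∷ p) (inj₂ zero)    = refl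
  split-unsplit (false ∷ p) (inj₂ (suc j)) = cong (Sum.map₂ suc) (split-unsplit p (inj₂ j))

  split-∈ : ∀ {n} (p : Subset n) {i} → i ∈ p → ∃ λ j → split p i ≡ inj₁ j
  split-∈ (_ ∷ p)     here        = zero , refl
  split-∈ (true ∷ p)  (there i∈p) with j , eq ← split-∈ p i∈p = suc j , cong (Sum.map₁ suc) eq
  split-∈ (false ∷ p) (there i∈p) with j , eq ← split-∈ p i∈p = j , cong (Sum.map₂ suc) eq

  split-∉ : ∀ {n} (p : Subset n) {i} → i ∈ ∁ p → ∃ λ j → split p i ≡ inj₂ j
  split-∉ (false ∷ p) here        = zero , refl
  split-∉ (true ∷ p)  (there i∈p) with j , eq ← split-∉ p i∈p = j , cong (Sum.map₁ suc) eq
  split-∉ (false ∷ p) (there i∈p) with j , eq ← split-∉ p i∈p = suc j , cong (Sum.map₂ suc) eq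

  split-↔ : ∀ {n} (p : Subset n) → Fin n ↔ (Fin (card p) ⊎ Fin (card (∁ p)))
  split-↔ p = mk↔ₛ′ (split p) (unsplit p) (split-unsplit p) (unsplit-split p)

-- Edge counting and completeness in a bipartite graph.

module Bipartite (G : Graph) where

  open Graph G using (Vertex; Adj; adj?; neighbourhood; degrees)
  open import Data.Nat.Base using (_+_; _*_; _≤_; _<_)
  open Sums
  open Finite

  ∈-neighbourhood⁺ : ∀ {u w} → Adj u w → w ∈ neighbourhood u
  ∈-neighbourhood⁺ {u} = ∈-comprehension⁺ (adj? u)

  ∈-neighbourhood⁻ : ∀ {u w} → w ∈ neighbourhood u → Adj u w
  ∈-neighbourhood⁻ {u} = ∈-comprehension⁻ (adj? u)

  degree-sum : ∀ u → degree G u ≡ ∑[ w < order G ] 𝟙 (does (adj? u w))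
  degree-sum u = trans (card-sum (neighbourhood u))
                       (sum-cong-≗ λ w → cong 𝟙 (lookup∘tabulate (does ∘ adj? u) w))

  IsBipartition-swap : ∀ {X Y} → IsBipartition G X Y → IsBipartition G Y X
  IsBipartition-swap XY = record
    { cover        = Sum.swap ∘ cover
    ; disjoint     = λ v∈Y v∈X → disjoint v∈X v∈Y
    ; independentˣ = independentʸ
    ; independentʸ = independentˣ
    }
    where open Graph.IsBipartition XY

  module _ {X Y : Subset (order G)} (XY : IsBipartition G X Y) where

    open Graph.IsBipartition XY

    adj-∈ˣ : ∀ {u w} → u ∈ X → Adj u w → w ∈ Y
    adj-∈ˣ {w = w} u∈X uw with cover w
    ... | inj₁ w∈X = contradiction uw (independentˣ u∈X w∈X)
    ... | inj₂ w∈Y = w∈Y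

    complement : Y ≡ ∁ X
    complement = ⊆-antisym
      (λ v∈Y → x∉p⇒x∈∁p λ v∈X → disjoint v∈X v∈Y)
      (λ {v} v∈∁X → [ (λ v∈X → contradiction v∈X (x∈∁p⇒x∉p v∈∁X)) , id ]′ (cover v))

    card-+ : card X + card Y ≡ order G
    card-+ = trans (cong (λ Z → card X + card Z) complement)
                   (trans (cong (_+_ (card X)) (∣∁p∣≡n∸∣p∣ X)) (m+[n∸m]≡n (∣p∣≤n X)))

    private
      inX inY : Vertex → ℕ
      inX = 𝟙 ∘ lookup X
      inY = 𝟙 ∘ lookup Y

      ∈⇒inY : ∀ {v} → v ∈ Y → inY v ≡ 1
      ∈⇒inY v∈Y = cong 𝟙 ([]=⇒lookup v∈Y)

      ∉⇒inY : ∀ {v} → v ∈ X → inY v ≡ 0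
      ∉⇒inY {v} v∈X with lookup Y v in eq
      ... | true  = contradiction (lookup⇒[]= v Y eq) (disjoint v∈X)
      ... | false = refl

      edge : Vertex → Vertex → ℕ
      edge u w = 𝟙 (does ((u Fin.<? w) ×-dec adj? u w))

      inY-+ : ∀ {u w} → Adj u w → inY u + inY w ≡ 1
      inY-+ {u} {w} uw with cover u | cover w
      ... | inj₁ u∈X | _        = cong₂ _+_ (∉⇒inY u∈X) (∈⇒inY (adj-∈ˣ u∈X uw))
      ... | inj₂ u∈Y | inj₁ w∈X = cong₂ _+_ (∈⇒inY u∈Y) (∉⇒inY w∈X)
      ... | inj₂ u∈Y | inj₂ w∈Y = contradiction uw (independentʸ u∈Y w∈Y)

      -- An edge has exactly one end in `Y` by `inY-+`, so it can be charged to that end.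
      edge-endpoints : ∀ u w → edge u w ≡ inY u * edge u w + inY w * edge u w
      edge-endpoints u w with adj? u w
      ... | no _   rewrite ∧-zeroʳ (does (u Fin.<? w)) | *-zeroʳ (inY u) | *-zeroʳ (inY w) = refl
      ... | yes uw = sym (trans (sym (*-distribʳ-+ e (inY u) (inY w)))
                                (trans (cong (λ c → c * e) (inY-+ uw)) (*-identityˡ e)))
        where e = 𝟙 (does (u Fin.<? w) ∧ true)

      -- `edge` counts increasing pairs only; by trichotomy exactly one of the two orders of an
      -- adjacent pair is increasing.
      edge-orientations : ∀ u w → edge u w + edge w u ≡ 𝟙 (does (adj? u w))
      edge-orientations u w with adj? u w | adj? w u
      ... | yes uw | no ¬wu = contradiction (Graph.sym G uw) ¬wu
      ... | no ¬uw | yes wu = contradiction (Graph.sym G wu) ¬uw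
      ... | no _   | no _
        rewrite ∧-zeroʳ (does (u Fin.<? w)) | ∧-zeroʳ (does (w Fin.<? u)) = refl
      ... | yes uw | yes _ with Fin.<-cmp u w
      ...   | tri< u<w _ w≮u rewrite dec-true (u Fin.<? w) u<w | dec-false (w Fin.<? u) w≮u = refl
      ...   | tri≈ _ u≡w _   = contradiction uw (Graph.irrefl G u≡w)
      ...   | tri> u≮w _ w<u rewrite dec-false (u Fin.<? w) u≮w | dec-true (w Fin.<? u) w<u = refl

    size-sum : size G ≡ ∑[ u < order G ] (inY u * degree G u)
    size-sum = begin
      size G
        ≡⟨ length-filter-cartesianProduct (λ (u , w) → (u Fin.<? w) ×-dec adj? u w) id id ⟩
      ∑[ u < n ] ∑[ w < n ] edge u w
        ≡⟨ sum-cong-≗ (λ u → trans (sum-cong-≗ (edge-endpoints u)) (∑-distrib-+ (λ w → inY u * edge u w) _)) ⟩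
      ∑[ u < n ] (∑[ w < n ] (inY u * edge u w) + ∑[ w < n ] (inY w * edge u w))
        ≡⟨ ∑-distrib-+ (λ u → ∑[ w < n ] (inY u * edge u w)) _ ⟩
      ∑[ u < n ] ∑[ w < n ] (inY u * edge u w) + ∑[ u < n ] ∑[ w < n ] (inY w * edge u w)
        -- Exchanging the sums in the second half gathers, in row `u`, both orders of each pair
        -- containing `u`, all with weight `inY u`.
        ≡⟨ cong (_+_ (∑[ u < n ] ∑[ w < n ] (inY u * edge u w))) (∑-comm (λ u w → inY w * edge u w)) ⟩
      ∑[ u < n ] ∑[ w < n ] (inY u * edge u w) + ∑[ u < n ] ∑[ w < n ] (inY u * edge w u)
        ≡⟨ ∑-distrib-+ (λ u → ∑[ w < n ] (inY u * edge u w)) _ ⟨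
      ∑[ u < n ] (∑[ w < n ] (inY u * edge u w) + ∑[ w < n ] (inY u * edge w u))
        ≡⟨ sum-cong-≗ row ⟩
      ∑[ u < n ] (inY u * degree G u) ∎
      where
      open ≡-Reasoning
      n = order G
      row : ∀ u → ∑[ w < n ] (inY u * edge u w) + ∑[ w < n ] (inY u * edge w u) ≡ inY u * degree G u
      row u = begin
        ∑[ w < n ] (inY u * edge u w) + ∑[ w < n ] (inY u * edge w u)
          ≡⟨ ∑-distrib-+ (λ w → inY u * edge u w) _ ⟨
        ∑[ w < n ] (inY u * edge u w + inY u * edge w u)
          ≡⟨ sum-cong-≗ (λ w → trans (sym (*-distribˡ-+ (inY u) (edge u w) _))
                                     (cong (_*_ (inY u)) (edge-orientations u w))) ⟩
        ∑[ w < n ] (inY u * 𝟙 (does (adj? u w)))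
          ≡⟨ *-distribˡ-sum (inY u) (λ w → 𝟙 (does (adj? u w))) ⟨
        inY u * ∑[ w < n ] 𝟙 (does (adj? u w))
          ≡⟨ cong (_*_ (inY u)) (degree-sum u) ⟨
        inY u * degree G u ∎

    module _ (d : ℕ) where

      private
        constant-sum : card Y * d ≡ ∑[ u < order G ] (inY u * d)
        constant-sum = trans (cong (λ c → c * d) (card-sum Y)) (*-distribʳ-sum d inY)

        weighted-≤ : (∀ {y} → y ∈ Y → degree G y ≤ d) → ∀ u → inY u * degree G u ≤ inY u * d
        weighted-≤ Y≤d u with cover u
        ... | inj₁ u∈X rewrite ∉⇒inY u∈X = z≤n
        ... | inj₂ u∈Y = *-monoʳ-≤ (inY u) (Y≤d u∈Y)

      size-≤ : (∀ {y} → y ∈ Y → degree G y ≤ d) → size G ≤ card Y * d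
      size-≤ Y≤d = subst₂ _≤_ (sym size-sum) (sym constant-sum) (sum-mono-≤ (weighted-≤ Y≤d))

      size-≤-equality : (∀ {y} → y ∈ Y → degree G y ≤ d) → size G ≡ card Y * d →
                        ∀ {y} → y ∈ Y → degree G y ≡ d
      -- The weight of a vertex of `Y` is 1, so it cancels from the termwise equality.
      size-≤-equality Y≤d eq {y} y∈Y = *-cancelˡ-≡ _ _ 1
        (subst (λ i → i * degree G y ≡ i * d) (∈⇒inY y∈Y)
          (sum-≤-equality (weighted-≤ Y≤d) (trans (sym size-sum) (trans eq constant-sum)) y))

      size-regular : (∀ {y} → y ∈ Y → degree G y ≡ d) → size G ≡ card Y * d
      size-regular Y≡d = trans size-sum (trans (sum-cong-≗ weighted-≡) (sym constant-sum))
        where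
        weighted-≡ : ∀ u → inY u * degree G u ≡ inY u * d
        weighted-≡ u with cover u
        ... | inj₁ u∈X rewrite ∉⇒inY u∈X = refl
        ... | inj₂ u∈Y = cong (_*_ (inY u)) (Y≡d u∈Y)

    complete⇒≅K : (∀ {x y} → x ∈ X → y ∈ Y → Adj x y) → G ≅ K (card X) (card Y)
    complete⇒≅K complete = subst (λ Z → G ≅ K (card X) (card Z)) (sym complement) record
      { bijection = sum↔+ ↔-∘ split-↔ X
      ; adjacency = λ u w → subst₂ (λ a b → Adj u w ⇔ OppositeSides a b)
          (sym (splitAt-join (card X) _ (split X u))) (sym (splitAt-join (card X) _ (split X w)))
          (adj⇔opposite u w)
      }
      where
      sum↔+ : (Fin (card X) ⊎ Fin (card (∁ X))) ↔ Fin (card X + card (∁ X))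
      sum↔+ = mk↔ₛ′ (join (card X) _) (splitAt (card X)) (Fin.join-splitAt (card X) _) (splitAt-join (card X) _)
      ∈∁ : ∀ {y} → y ∈ Y → y ∈ ∁ X
      ∈∁ = subst (_ ∈_) complement
      adj⇔opposite : ∀ u w → Adj u w ⇔ OppositeSides (split X u) (split X w)
      adj⇔opposite u w with cover u | cover w
      ... | inj₁ u∈X | inj₁ w∈X rewrite proj₂ (split-∈ X u∈X) | proj₂ (split-∈ X w∈X) =
        mk⇔ (independentˣ u∈X w∈X) λ ()
      ... | inj₁ u∈X | inj₂ w∈Y rewrite proj₂ (split-∈ X u∈X) | proj₂ (split-∉ X (∈∁ w∈Y)) =
        mk⇔ (λ _ → tt) λ _ → complete u∈X w∈Y
      ... | inj₂ u∈Y | inj₁ w∈X rewrite proj₂ (split-∉ X (∈∁ u∈Y)) | proj₂ (split-∈ X w∈X) =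
        mk⇔ (λ _ → tt) λ _ → Graph.sym G (complete w∈X u∈Y)
      ... | inj₂ u∈Y | inj₂ w∈Y rewrite proj₂ (split-∉ X (∈∁ u∈Y)) | proj₂ (split-∉ X (∈∁ w∈Y)) =
        mk⇔ (independentʸ u∈Y w∈Y) λ ()

-- Degrees, depth and parity in a connected `k`-SI graph.

module StepwiseIrregularGraph
  (k : ℕ) (1≤k : 1 ℕ.≤ k) (G : Graph) (2≤n : 2 ℕ.≤ order G)
  (connected : Connected G) (irregular : StepwiseIrregular G k)
  where

  open Graph G using (Vertex; Adj; adj?; neighbourhood; degrees)
  open import Data.Nat.Base using (_+_; _*_; _≤_; _<_)
  open Finite
  open Bipartite G

  private
    d : Vertex → ℕ
    d = degree G

    Δ e : ℕ
    Δ = maxDegree G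
    e = Δ ∸ k

    +k-< : ∀ {a b} → a + k ≡ b → a < b
    +k-< {a} refl = m<m+n a 1≤k

  d≤Δ : ∀ u → d u ≤ Δ
  d≤Δ u = All.lookup (xs≤max 0 degrees) (∈-map⁺ d (∈-allFin u))

  maximal : ∃ λ v → d v ≡ Δ
  maximal with argmax-sel id 0 degrees
  ... | inj₂ Δ∈degrees with v , _ , Δ≡dv ← ∈-map⁻ d Δ∈degrees = v , sym Δ≡dv
  -- The maximum may be the default 0 instead of an entry of the list; then every degree is 0 and
  -- any vertex serves.
  ... | inj₁ Δ≡0 = u , ≤-antisym (d≤Δ u) (≤-trans (≤-reflexive Δ≡0) z≤n)
    where u = fromℕ< (≤-trans (s≤s z≤n) 2≤n)

  -- A walk to some other vertex cannot be empty, and its first step is the required edge.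
  neighbour : ∀ u → ∃ λ w → Adj u w
  neighbour u with w , u≢w ← another 2≤n u with connected u w
  ... | ε      = contradiction refl u≢w
  ... | uw ◅ _ = _ , uw

  -- Connectedness as an induction principle: an invariant is checked across one edge only. Depth,
  -- the two sides, the star and the three admissible degrees are all obtained this way.
  propagate : (P : Vertex → Set) → (∀ {u w} → Adj u w → P u → P w) →
              ∀ {u} → P u → ∀ w → P w
  propagate P step {u} Pu w = along (connected u w) Pu
    where
    along : ∀ {u w} → Star Adj u w → P u → P w
    along ε         Pu = Pu
    along (uw ◅ ws) Pu = along ws (step uw Pu)

  d-step : ∀ {u w} → Adj u w → d u + k ≡ d w ⊎ d w + k ≡ d u
  d-step {u} {w} uw = ∣-∣≡⇒+≡ (d u) (d w) (irregular uw)

  d-positive : ∀ {u w} → Adj u w → 1 ≤ d u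
  d-positive {u} {w} uw = subst (_≤ d u) (∣⁅x⁆∣≡1 w)
    (p⊆q⇒∣p∣≤∣q∣ λ x∈⁅w⁆ → subst (_∈ neighbourhood u) (sym (x∈⁅y⁆⇒x≡y w x∈⁅w⁆)) (∈-neighbourhood⁺ uw))

  -- The degree cannot rise along the edge, since a rise by the positive `k` would exceed `Δ`.
  maximal-step : ∀ {u w} → d u ≡ Δ → Adj u w → d w + k ≡ Δ
  maximal-step {u} {w} du≡Δ uw with d-step uw
  ... | inj₁ du+k≡dw = contradiction (d≤Δ w) (<⇒≱ (subst (_< d w) du≡Δ (+k-< du+k≡dw)))
  ... | inj₂ dw+k≡du = trans dw+k≡du du≡Δ

  k≤Δ : k ≤ Δ
  k≤Δ with v , dv≡Δ ← maximal with w , vw ← neighbour v =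
    ≤-trans (m≤n+m k (d w)) (≤-reflexive (maximal-step dv≡Δ vw))

  e+k≡Δ : e + k ≡ Δ
  e+k≡Δ = m∸n+n≡m k≤Δ

  +k≡Δ⇒≡e : ∀ {a} → a + k ≡ Δ → a ≡ e
  +k≡Δ⇒≡e eq = +-cancelʳ-≡ k _ _ (trans eq (sym e+k≡Δ))

  1≤e : 1 ≤ e
  1≤e with v , dv≡Δ ← maximal with w , vw ← neighbour v =
    subst (1 ≤_) (+k≡Δ⇒≡e (maximal-step dv≡Δ vw)) (d-positive (Graph.sym G vw))

  private
    depth-exists : ∀ u → ∃ λ q → d u + q * k ≡ Δ
    depth-exists = propagate _ step (0 , trans (+-identityʳ _) (proj₂ maximal))
      where
      step : ∀ {u w} → Adj u w → ∃ (λ q → d u + q * k ≡ Δ) → ∃ (λ q → d w + q * k ≡ Δ)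
      step {u} {w} uw (q , eq) with d-step uw
      -- At `q = 0` the degree is already `Δ`, so no neighbour has a larger one.
      step {u} {w} uw (zero , eq) | inj₁ du+k≡dw =
        contradiction (d≤Δ w) (<⇒≱ (subst (_< d w) (trans (sym (+-identityʳ _)) eq) (+k-< du+k≡dw)))
      step {u} {w} uw (suc q , eq) | inj₁ du+k≡dw =
        q , trans (cong (λ c → c + q * k) (sym du+k≡dw)) (trans (+-assoc (d u) k (q * k)) eq)
      step {u} {w} uw (q , eq) | inj₂ dw+k≡du =
        suc q , trans (sym (+-assoc (d w) k (q * k))) (trans (cong (λ c → c + q * k) dw+k≡du) eq)

  -- How many steps of size `k` the degree lies below `Δ`. It is found along a walk, but
  -- `depth-unique` shows that it depends on the degree alone.
  depth : Vertex → ℕ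
  depth u = proj₁ (depth-exists u)

  d+depth*k : ∀ u → d u + depth u * k ≡ Δ
  d+depth*k u = proj₂ (depth-exists u)

  depth-unique : ∀ u {q} → d u + q * k ≡ Δ → depth u ≡ q
  depth-unique u {q} eq =
    *-cancelʳ-≡ _ _ k {{>-nonZero 1≤k}} (+-cancelˡ-≡ (d u) _ _ (trans (d+depth*k u) (sym eq)))

  depth-maximal : ∀ {v} → d v ≡ Δ → depth v ≡ 0
  depth-maximal {v} dv≡Δ = depth-unique v {0} (trans (+-identityʳ _) dv≡Δ)

  depth-+k : ∀ {u w} → d u + k ≡ d w → depth u ≡ suc (depth w)
  depth-+k {u} {w} eq = depth-unique u
    (trans (sym (+-assoc (d u) k _)) (trans (cong (λ c → c + depth w * k) eq) (d+depth*k w)))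

  -- Degrees that differ by `k` have depths that differ by one.
  parity-depth-step : ∀ {u w} → Adj u w → parity (depth w) ≡ parity (depth u) ⁻¹
  parity-depth-step {u} {w} uw with d-step uw
  ... | inj₁ eq = sym (trans (cong (λ q → parity q ⁻¹) (depth-+k eq)) (suc-homo-⁻¹ (depth w)))
  ... | inj₂ eq = trans (cong parity (depth-+k eq)) (sym (⁻¹-selfInverse (suc-homo-⁻¹ (depth u))))

  private
    even? : Decidable λ u → parity (depth u) ≡ 0ℙ
    even? u = parity (depth u) ≟ᵖ 0ℙ

    ≢0ℙ⇒≡1ℙ : ∀ {p} → p ≢ 0ℙ → p ≡ 1ℙ
    ≢0ℙ⇒≡1ℙ {0ℙ} p≢0ℙ = contradiction refl p≢0ℙ
    ≢0ℙ⇒≡1ℙ {1ℙ} _    = refl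

  -- The upper bound is stated without a bipartition; the parity classes of depth provide one with a
  -- vertex of maximum degree in the first part.
  evens : Subset (order G)
  evens = comprehension even?

  evens-bipartition : IsBipartition G evens (∁ evens)
  evens-bipartition = record
    { cover        = cover
    ; disjoint     = x∈p⇒x∉∁p
    ; independentˣ = λ u∈ w∈ → independent (∈-comprehension⁻ even? u∈) (∈-comprehension⁻ even? w∈)
    ; independentʸ = λ u∈ w∈ → independent (odd u∈) (odd w∈)
    }
    where
    cover : ∀ u → u ∈ evens ⊎ u ∈ ∁ evens
    cover u with u ∈? evens
    ... | yes u∈ = inj₁ u∈
    ... | no  u∉ = inj₂ (x∉p⇒x∈∁p u∉)
    odd : ∀ {u} → u ∈ ∁ evens → parity (depth u) ≡ 1ℙ
    odd u∈∁ = ≢0ℙ⇒≡1ℙ (x∈∁p⇒x∉p u∈∁ ∘ ∈-comprehension⁺ even?)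
    independent : ∀ {u w p} → parity (depth u) ≡ p → parity (depth w) ≡ p → ¬ Adj u w
    independent {p = p} u≡p w≡p uw =
      p≢p⁻¹ p (trans (sym w≡p) (trans (parity-depth-step uw) (cong _⁻¹ u≡p)))

  maximal∈evens : ∃ λ v → v ∈ evens × d v ≡ Δ
  maximal∈evens =
    v , ∈-comprehension⁺ even? (cong parity (depth-maximal dv≡Δ)) , dv≡Δ
    where
    v    = proj₁ maximal
    dv≡Δ = proj₂ maximal

  ≤-degreeComplexity : ∀ {ds} → Unique ds → (∀ {c} → c ∈ˡ ds → ∃ λ u → d u ≡ c) →
                       length ds ≤ degreeComplexity G
  ≤-degreeComplexity ds! occurs = Unique-⊆⇒length-≤ ds! λ c∈ds →
    let u , du≡c = occurs c∈ds
    in ∈-deduplicate⁺ _≟_ (subst (_∈ˡ degrees) du≡c (∈-map⁺ d (∈-allFin u)))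

  degreeComplexity-≤ : ∀ {ds} → (∀ u → d u ∈ˡ ds) → degreeComplexity G ≤ length ds
  degreeComplexity-≤ {ds} d∈ds = Unique-⊆⇒length-≤ (deduplicate-! _≟_ degrees) λ c∈ →
    let u , _ , c≡du = ∈-map⁻ d (∈-deduplicate⁻ _≟_ degrees c∈)
    in subst (_∈ˡ ds) (sym c≡du) (d∈ds u)

  -- A bipartition with a vertex `v` of maximum degree in `X`.

  module Parts {X Y : Subset (order G)} (XY : IsBipartition G X Y)
               {v : Vertex} (v∈X : v ∈ X) (dv≡Δ : d v ≡ Δ) where

    open Graph.IsBipartition XY

    private
      YX : IsBipartition G Y X
      YX = IsBipartition-swap XY

    neighbour-d≡e : ∀ {w} → Adj v w → d w ≡ e
    neighbour-d≡e vw = +k≡Δ⇒≡e (maximal-step dv≡Δ vw)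

    -- The vertex `v` lies in `X` at depth 0, and each edge switches both the part and the parity,
    -- so any such bipartition is the one by parity.
    sides : ∀ u → (u ∈ X × parity (depth u) ≡ 0ℙ) ⊎ (u ∈ Y × parity (depth u) ≡ 1ℙ)
    sides = propagate _ step
      (inj₁ (v∈X , cong parity (depth-maximal dv≡Δ)))
      where
      step : ∀ {u w} → Adj u w → (u ∈ X × parity (depth u) ≡ 0ℙ) ⊎ (u ∈ Y × parity (depth u) ≡ 1ℙ) →
             (w ∈ X × parity (depth w) ≡ 0ℙ) ⊎ (w ∈ Y × parity (depth w) ≡ 1ℙ)
      step uw (inj₁ (u∈X , eq)) = inj₂ (adj-∈ˣ XY u∈X uw , trans (parity-depth-step uw) (cong _⁻¹ eq))
      step uw (inj₂ (u∈Y , eq)) = inj₁ (adj-∈ˣ YX u∈Y uw , trans (parity-depth-step uw) (cong _⁻¹ eq))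

    d≤e : ∀ {y} → y ∈ Y → d y ≤ e
    d≤e {y} y∈Y with sides y
    ... | inj₁ (y∈X , _) = contradiction y∈Y (disjoint y∈X)
    ... | inj₂ (_ , odd) with depth y | d+depth*k y
    -- Depth 0 is not odd, so at least one `k` can be split off.
    ...   | suc q | eq = m+n≤o⇒m≤o∸n (d y)
      (≤-trans (+-monoʳ-≤ (d y) (m≤m+n k (q * k))) (≤-reflexive eq))

    private
      N⊆X : ∀ {y} → y ∈ Y → neighbourhood y ⊆ X
      N⊆X y∈Y x∈N = adj-∈ˣ YX y∈Y (∈-neighbourhood⁻ x∈N)

    e≤card-X : e ≤ card X
    e≤card-X with w , vw ← neighbour v =
      subst (_≤ card X) (neighbour-d≡e vw) (p⊆q⇒∣p∣≤∣q∣ (N⊆X (adj-∈ˣ XY v∈X vw)))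

    module _ (X≤e : card X ≤ e) where

      private
        -- A neighbour of `v` has `e` neighbours, all in `X`; when `card X ≤ e` they exhaust `X`, so
        -- `x` is among them.
        N-v⊆ : ∀ {x} → x ∈ X → neighbourhood v ⊆ neighbourhood x
        N-v⊆ x∈X w∈N = ∈-neighbourhood⁺ (Graph.sym G (∈-neighbourhood⁻
          (⊆∧card≥⇒⊇ (N⊆X (adj-∈ˣ XY v∈X vw)) (subst (card X ≤_) (sym (neighbour-d≡e vw)) X≤e) x∈X)))
          where vw = ∈-neighbourhood⁻ w∈N

        -- A vertex `y` has a neighbour `x` in `X`. The neighbourhood of `x` contains that of `v`
        -- and is no larger, because `v` has maximum degree; hence the two coincide and contain `y`.
        Y⊆N-v : Y ⊆ neighbourhood v
        Y⊆N-v {y} y∈Y with x , yx ← neighbour y =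
          ⊆∧card≥⇒⊇ (N-v⊆ (adj-∈ˣ YX y∈Y yx)) (≤-trans (d≤Δ x) (≤-reflexive (sym dv≡Δ)))
            (∈-neighbourhood⁺ (Graph.sym G yx))

        card-Y≡Δ : card Y ≡ Δ
        card-Y≡Δ = trans (cong card (⊆-antisym Y⊆N-v (adj-∈ˣ XY v∈X ∘ ∈-neighbourhood⁻))) dv≡Δ

      card-X≤e⇒≅K : G ≅ K Δ e
      -- The larger part, of size `Δ`, is `Y`, so the parts are taken in swapped order.
      card-X≤e⇒≅K = subst₂ (λ p q → G ≅ K p q) card-Y≡Δ (≤-antisym X≤e e≤card-X)
        (complete⇒≅K YX λ y∈Y x∈X → Graph.sym G (∈-neighbourhood⁻ (N-v⊆ x∈X (Y⊆N-v y∈Y))))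

    size≤ : size G ≤ card Y * e
    size≤ = size-≤ XY e d≤e

    -- The neighbours of v are leaves, so a walk from v stays within v and its neighbours.
    e≡1⇒card-X≤1 : e ≡ 1 → card X ≤ 1
    e≡1⇒card-X≤1 e≡1 = subst (card X ≤_) (∣⁅x⁆∣≡1 v) (p⊆q⇒∣p∣≤∣q∣ X⊆⁅v⁆)
      where
      star : ∀ u → u ≡ v ⊎ Adj v u
      star = propagate _ step (inj₁ refl)
        where
        step : ∀ {u w} → Adj u w → u ≡ v ⊎ Adj v u → w ≡ v ⊎ Adj v w
        step uw (inj₁ refl) = inj₂ uw
        step uw (inj₂ vu)   = inj₁ (card≡1⇒unique (trans (neighbour-d≡e vu) e≡1)
          (∈-neighbourhood⁺ (Graph.sym G vu)) (∈-neighbourhood⁺ uw))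
      X⊆⁅v⁆ : X ⊆ ⁅ v ⁆
      X⊆⁅v⁆ {x} x∈X with star x
      ... | inj₁ refl = x∈⁅x⁆ v
      ... | inj₂ vx   = contradiction vx (independentˣ v∈X x∈X)

    -- The equality case: degrees when `Y` is regular, and the converse.

    module _ (dY≡e : ∀ {y} → y ∈ Y → d y ≡ e) where

      d-X : ∀ {x} → x ∈ X → d x ≡ Δ ⊎ d x + k ≡ e
      d-X {x} x∈X with y , xy ← neighbour x with dY≡e (adj-∈ˣ XY x∈X xy) | d-step xy
      ... | dy≡e | inj₁ dx+k≡dy = inj₂ (trans dx+k≡dy dy≡e)
      ... | dy≡e | inj₂ dy+k≡dx = inj₁ (trans (sym dy+k≡dx) (trans (cong (λ c → c + k) dy≡e) e+k≡Δ))

      low-degree : gcd Δ k ≡ 1 → card X ≡ suc e → ∃ λ x → d x + k ≡ e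
      low-degree coprime card-X with Fin.any? (λ x → d x + k ≟ e)
      ... | yes low = low
      -- Here `e` is 1, so `card X` would be 2, while a star has a single vertex in `X`.
      ... | no ¬low = contradiction (subst (_≤ 1) (trans card-X (cong suc e≡1)) (e≡1⇒card-X≤1 e≡1)) λ { (s≤s ()) }
        where
        dX≡Δ : ∀ {x} → x ∈ X → d x ≡ Δ
        dX≡Δ {x} x∈X = [ id , (λ low → contradiction (x , low) ¬low) ]′ (d-X x∈X)
        double-count : Δ + e * Δ ≡ card Y * e
        -- Both parts are regular, so `size G` is counted from either one; `suc e * Δ` unfolds to
        -- `Δ + e * Δ`, isolating the `Δ` that `e` must divide.
        double-count = trans (sym (cong (λ c → c * Δ) card-X))
          (trans (sym (size-regular YX Δ dX≡Δ)) (size-regular XY e dY≡e))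
        e∣Δ : e ∣ Δ
        e∣Δ = ∣m+n∣m⇒∣n (divides (card Y) (trans (+-comm (e * Δ) Δ) double-count)) (m∣m*n Δ)
        e∣k : e ∣ k
        e∣k = ∣m+n∣m⇒∣n (subst (e ∣_) (sym e+k≡Δ) e∣Δ) ∣-refl
        e≡1 : e ≡ 1
        e≡1 = ∣1⇒≡1 (subst (e ∣_) coprime (gcd-greatest e∣Δ e∣k))

      degreeComplexity≡3 : gcd Δ k ≡ 1 → card X ≡ suc e → degreeComplexity G ≡ 3
      degreeComplexity≡3 coprime card-X with l , dl+k≡e ← low-degree coprime card-X =
        ≤-antisym (degreeComplexity-≤ d∈) (≤-degreeComplexity distinct occurs)
        where
        ds = Δ ∷ e ∷ d l ∷ []
        d∈ : ∀ u → d u ∈ˡ ds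
        d∈ u with cover u
        ... | inj₂ u∈Y = there (here (dY≡e u∈Y))
        ... | inj₁ u∈X with d-X u∈X
        ...   | inj₁ du≡Δ = here du≡Δ
        ...   | inj₂ eq   = there (there (here (+-cancelʳ-≡ k _ _ (trans eq (sym dl+k≡e)))))
        l<e = +k-< dl+k≡e
        e<Δ = +k-< e+k≡Δ
        distinct : Unique ds
        distinct = (>⇒≢ e<Δ ∷ >⇒≢ (<-trans l<e e<Δ) ∷ []) ∷ (>⇒≢ l<e ∷ []) ∷ [] ∷ []
        occurs : ∀ {c} → c ∈ˡ ds → ∃ λ u → d u ≡ c
        occurs (here refl) = v , dv≡Δ
        occurs (there (here refl)) with w , vw ← neighbour v = w , neighbour-d≡e vw
        occurs (there (there (here refl))) = l , refl

    -- A walk from `v` meets only the degrees `Δ`, `e` and `e - k`: the only way out is a step down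
    -- from `e - k`, and that would exhibit a fourth degree.
    degreeComplexity≡3⇒dY≡e : degreeComplexity G ≡ 3 → ∀ {y} → y ∈ Y → d y ≡ e
    degreeComplexity≡3⇒dY≡e C≡3 {y} y∈Y =
      [ (λ (y∈X , _) → contradiction y∈Y (disjoint y∈X)) , proj₂ ]′
        (propagate Inv step (inj₁ (v∈X , inj₁ dv≡Δ)) y)
      where
      Inv : Vertex → Set
      Inv u = (u ∈ X × (d u ≡ Δ ⊎ d u + k ≡ e)) ⊎ (u ∈ Y × d u ≡ e)
      four-degrees : ∀ {x y} → d x + k ≡ e → d y + k ≡ d x → 4 ≤ degreeComplexity G
      four-degrees {x} {y} dx+k≡e dy+k≡dx = ≤-degreeComplexity
        ((>⇒≢ e<Δ ∷ >⇒≢ (<-trans x<e e<Δ) ∷ >⇒≢ (<-trans y<x (<-trans x<e e<Δ)) ∷ []) ∷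
         (>⇒≢ x<e ∷ >⇒≢ (<-trans y<x x<e) ∷ []) ∷ (>⇒≢ y<x ∷ []) ∷ [] ∷ [])
        occurs
        where
        y<x = +k-< dy+k≡dx
        x<e = +k-< dx+k≡e
        e<Δ = +k-< e+k≡Δ
        occurs : ∀ {c} → c ∈ˡ (Δ ∷ e ∷ d x ∷ d y ∷ []) → ∃ λ u → d u ≡ c
        occurs (here refl) = v , dv≡Δ
        occurs (there (here refl)) with w , vw ← neighbour v = w , neighbour-d≡e vw
        occurs (there (there (here refl))) = x , refl
        occurs (there (there (there (here refl)))) = y , refl
      step : ∀ {u w} → Adj u w → Inv u → Inv w
      step uw (inj₁ (u∈X , inj₁ du≡Δ)) = inj₂ (adj-∈ˣ XY u∈X uw , +k≡Δ⇒≡e (maximal-step du≡Δ uw))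
      step uw (inj₁ (u∈X , inj₂ du+k≡e)) with d-step uw
      ... | inj₁ du+k≡dw = inj₂ (adj-∈ˣ XY u∈X uw , trans (sym du+k≡dw) du+k≡e)
      ... | inj₂ dw+k≡du = contradiction (subst (4 ≤_) C≡3 (four-degrees du+k≡e dw+k≡du)) (<⇒≱ ≤-refl)
      step uw (inj₂ (u∈Y , du≡e)) with d-step uw
      ... | inj₁ du+k≡dw = inj₁ (adj-∈ˣ YX u∈Y uw ,
        inj₁ (trans (sym du+k≡dw) (trans (cong (λ c → c + k) du≡e) e+k≡Δ)))
      ... | inj₂ dw+k≡du = inj₁ (adj-∈ˣ YX u∈Y uw , inj₂ (trans dw+k≡du du≡e))

    -- The bound over the integers, and the characterization of equality.

    bound≡ : suc e ≤ card X →
             (+ Δ ℤ.- + k) ℤ.* (+ order G ℤ.- + Δ ℤ.+ + k ℤ.- ℤ.1ℤ) ≡ + (e * (card Y + (card X ∸ suc e)))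
    bound≡ e<X = begin
      (+ Δ ℤ.- + k) ℤ.* (+ order G ℤ.- + Δ ℤ.+ + k ℤ.- ℤ.1ℤ)
        ≡⟨ cong₂ (λ D n → (+ D ℤ.- + k) ℤ.* (+ n ℤ.- + D ℤ.+ + k ℤ.- ℤ.1ℤ)) (sym e+k≡Δ)
             (trans (sym (card-+ XY)) (cong (λ c → c + card Y) (sym (m+[n∸m]≡n e<X)))) ⟩
      -- The slack `card X ∸ suc e` is the `t` of `identity`. Integer sums of naturals compute to
      -- casts of natural sums, so only the product needs a conversion.
      _ ≡⟨ identity (+ e) (+ k) (+ card Y) (+ (card X ∸ suc e)) ⟩
      + e ℤ.* + (card Y + (card X ∸ suc e))
        ≡⟨ ℤ.pos-* e _ ⟨
      + (e * (card Y + (card X ∸ suc e))) ∎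
      where
      open ≡-Reasoning
      identity : ∀ e k y t →
        (e ℤ.+ k ℤ.- k) ℤ.* (ℤ.1ℤ ℤ.+ e ℤ.+ t ℤ.+ y ℤ.- (e ℤ.+ k) ℤ.+ k ℤ.- ℤ.1ℤ) ≡ e ℤ.* (y ℤ.+ t)
      identity = solve-∀

    Δ-k+1≡ : + Δ ℤ.- + k ℤ.+ ℤ.1ℤ ≡ + suc e
    Δ-k+1≡ = trans (cong (λ D → + D ℤ.- + k ℤ.+ ℤ.1ℤ) (sym e+k≡Δ)) (identity (+ e) (+ k))
      where
      identity : ∀ e k → e ℤ.+ k ℤ.- k ℤ.+ ℤ.1ℤ ≡ ℤ.1ℤ ℤ.+ e
      identity = solve-∀

    size≤bound : size G ≤ e * (card Y + (card X ∸ suc e))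
    size≤bound = ≤-trans size≤ (≤-trans (≤-reflexive (*-comm (card Y) e)) (*-monoʳ-≤ e (m≤m+n _ _)))

    -- The size is at most `card Y * e`, so reaching the bound leaves no room for slack, as `e` is
    -- positive.
    size≡bound⇒ : suc e ≤ card X → size G ≡ e * (card Y + (card X ∸ suc e)) →
                  card X ≡ suc e × size G ≡ card Y * e
    size≡bound⇒ e<X eq = card-X , trans eq (trans (cong (λ t → e * (card Y + t)) t≡0)
                                     (trans (cong (e *_) (+-identityʳ _)) (*-comm e _)))
      where
      t = card X ∸ suc e
      t≡0 : t ≡ 0
      t≡0 = n≤0⇒n≡0 (+-cancelˡ-≤ (card Y) _ _
        (*-cancelˡ-≤ e {{>-nonZero 1≤e}} (subst₂ _≤_ eq
          (trans (*-comm (card Y) e) (cong (e *_) (sym (+-identityʳ _)))) size≤)))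
      card-X : card X ≡ suc e
      card-X = trans (sym (m+[n∸m]≡n e<X)) (trans (cong (_+_ (suc e)) t≡0) (+-identityʳ _))

    -- Forwards, a tight edge count makes every degree in `Y` equal to `e`, and coprimality yields
    -- the third degree. Backwards, three degrees make `Y` regular, and the slack vanishes.
    extremal : gcd Δ k ≡ 1 → suc e ≤ card X →
               size G ≡ e * (card Y + (card X ∸ suc e)) ⇔ (degreeComplexity G ≡ 3 × card X ≡ suc e)
    extremal coprime e<X = mk⇔
      (λ eq → let card-X , size≡ = size≡bound⇒ e<X eq
              in degreeComplexity≡3 (size-≤-equality XY e d≤e size≡) coprime card-X , card-X)
      (λ (C≡3 , card-X) → trans (size-regular XY e (degreeComplexity≡3⇒dY≡e C≡3))
        (trans (*-comm (card Y) e) (cong (e *_) (trans (sym (+-identityʳ _))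
          (cong (_+_ (card Y)) (sym (trans (cong (_∸ suc e) card-X) (n∸n≡0 (suc e)))))))))

-- The bound from the parity bipartition, equality for an arbitrary one.

open import Data.Integer.Base using (_+_; _-_; _*_; _≤_; 1ℤ)

theorem5p4 : ∀ (k : ℕ) → 1 ℕ.≤ k →
    ∀ (G : Graph) → 2 ℕ.≤ order G → Connected G → StepwiseIrregular G k →
    let n = order G
        m = size G
        Δ = maxDegree G
        bound = (+ Δ - + k) * (+ n - + Δ + + k - 1ℤ)
    in
    ¬ (G ≅ K Δ (Δ ∸ k)) →
    gcd Δ k ≡ 1 →
    (+ m ≤ bound) ×
    (∀ (X Y : Subset n) → IsBipartition G X Y →
     (∃[ v ] (v ∈ X × degree G v ≡ Δ)) →
     (+ m ≡ bound ⇔ (degreeComplexity G ≡ 3 × + card X ≡ + Δ - + k + 1ℤ)))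
theorem5p4 k 1≤k G 2≤n connected irregular G≇K coprime = upper-bound , equality
  where
  open StepwiseIrregularGraph k 1≤k G 2≤n connected irregular

  upper-bound : + size G ≤ (+ maxDegree G - + k) * (+ order G - + maxDegree G + + k - 1ℤ)
  upper-bound with v , v∈ , dv≡Δ ← maximal∈evens =
    subst (+ size G ≤_) (sym (bound≡ e<X)) (ℤ.+≤+ size≤bound)
    where
    open Parts evens-bipartition v∈ dv≡Δ
    -- Excluding the complete bipartite graph raises the lower bound on `card X` from `e` to
    -- `suc e`.
    e<X = ≰⇒> (G≇K ∘ card-X≤e⇒≅K)

  equality : ∀ X Y → IsBipartition G X Y → (∃[ v ] (v ∈ X × degree G v ≡ maxDegree G)) →
    (+ size G ≡ (+ maxDegree G - + k) * (+ order G - + maxDegree G + + k - 1ℤ))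
      ⇔ (degreeComplexity G ≡ 3 × + card X ≡ + maxDegree G - + k + 1ℤ)
  equality X Y XY (v , v∈X , dv≡Δ) =
    subst₂ (λ b c → + size G ≡ b ⇔ (degreeComplexity G ≡ 3 × + card X ≡ c))
      (sym (bound≡ e<X)) (sym Δ-k+1≡)
      (mk⇔ (Product.map₂ (cong (λ c → + c)) ∘ to ∘ ℤ.+-injective)
           (cong (λ c → + c) ∘ from ∘ Product.map₂ ℤ.+-injective))
    where
    open Parts XY v∈X dv≡Δ
    e<X = ≰⇒> (G≇K ∘ card-X≤e⇒≅K)
    open Equivalence (extremal coprime e<X)
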